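{- Let $k,n$ be positive integers with $k\leqslant n$, and let $X\subseteq [n]^k_<$ have the quasi-exchange property. Then every linear extension of $X$ (with respect to the Bruhat order) is a shelling order.
   Context: $[n]:=\{1,\ldots,n\}$. $[n]^k_<$ denotes the set of $k$-element subsets of $[n]$, each identified with the increasing tuple $x=(x_1<\cdots<x_k)$ of its elements (so set operations $\cap,\cup,\setminus$ and the symmetric difference $A+B:=(A\setminus B)\cup(B\setminus A)$ make sense). A subset $X\subseteq[n]^k_<$ is viewed as (the set of facets of) a pure $(k-1)$-dimensional simplicial complex. The Bruhat order on $[n]^k_<$ is: $x\leqslant y$ iff $x_i\leqslant y_i$ for all $i\in[k]$. $\mathrm{Conf}([n]^k_<)$ is the set of finite tuples $C=(C_1,\ldots,C_h)$, $h\geqslant 1$, of pairwise distinct elements of $[n]^k_<$. A linear extension of $X$ is a tuple $L=(L_1,\ldots,L_h)$ listing every element of $X$ exactly once such that $L_i<L_j$ in the Bruhat order implies $i<j$. A tuple $C=(C_1,\ldots,C_h)\in\mathrm{Conf}([n]^k_<)$ is a shelling order if for all $i<j$ in $[h]$ there exists $z<j$ with $|C_z\cap C_j|=k-1$ and $C_i\cap C_j\subseteq C_z\cap C_j$. $X$ has the quasi-exchange property if for all $x,y\in X$ and every $i\in x\setminus y$ with $i>\max(y\setminus x)$, there exists $j\in y\setminus x$ such that $x+\{i,j\}\in X$. -}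

module Defs where

open import Data.Nat.Base as ℕ using (ℕ; _∸_)
open import Data.Fin.Base using (Fin; _≤_; _<_)
open import Data.Fin.Subset using (Subset; _∈_; _⊆_; _∩_; _∪_; _─_; ⁅_⁆; ∣_∣)
open import Data.Fin.Subset.Properties using (_∈?_)
open import Data.List.Base using (List; allFin; filter)
open import Data.List.Relation.Binary.Pointwise.Base using (Pointwise)
open import Data.Product using (_×_; ∃-syntax; ∃!)
open import Data.Vec.Functional using (Vector)
open import Function.Definitions using (Injective)
open import Level using (Level; 0ℓ)
open import Relation.Binary.PropositionalEquality.Core using (_≡_; _≢_)
open import Relation.Unary using (Pred)

private
  variable
    ℓ : Level
    n h : ℕ

-- [n] is represented by Fin n, with the 0-based shift of all elements.
-- KSubset n k is the set of k-element subsets of [n], as a predicate on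
-- Subset n; a family X of k-subsets is a predicate included in it.
KSubset : ∀ n → ℕ → Pred (Subset n) 0ℓ
KSubset n k x = ∣ x ∣ ≡ k

-- The increasing tuple (x₁ < ⋯ < x_k) identified with x: allFin lists Fin n
-- in increasing order and filter preserves that order.
elements : Subset n → List (Fin n)
elements {n} x = filter (_∈? x) (allFin n)

infix 4 _≤ᴮ_ _<ᴮ_

-- Pointwise only relates lists of equal length, so subsets of different
-- cardinalities are incomparable.
_≤ᴮ_ : Subset n → Subset n → Set
x ≤ᴮ y = Pointwise _≤_ (elements x) (elements y)

_<ᴮ_ : Subset n → Subset n → Set
x <ᴮ y = x ≤ᴮ y × x ≢ y

infixl 5 _△_

_△_ : Subset n → Subset n → Subset n
x △ y = (x ─ y) ∪ (y ─ x)

_IsMaxOf_ : Fin n → Subset n → Set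
m IsMaxOf x = m ∈ x × (∀ j → j ∈ x → j ≤ m)

-- For x and y of equal cardinality, i ∈ x ─ y forces y ─ x to be nonempty,
-- so its maximum m always exists here.  Since i and j are distinct,
-- ⁅ i ⁆ ∪ ⁅ j ⁆ is the pair {i, j}.
QuasiExchange : Pred (Subset n) ℓ → Set ℓ
QuasiExchange X =
  ∀ x y → X x → X y →
  ∀ i → i ∈ x ─ y → ∀ m → m IsMaxOf (y ─ x) → m < i →
  ∃[ j ] (j ∈ y ─ x × X (x △ (⁅ i ⁆ ∪ ⁅ j ⁆)))

record IsConf (k : ℕ) (C : Vector (Subset n) h) : Set where
  field
    nonempty : 1 ℕ.≤ h
    facets   : ∀ i → KSubset n k (C i)
    distinct : Injective _≡_ _≡_ C

record IsLinearExtension (X : Pred (Subset n) ℓ) (L : Vector (Subset n) h) : Set ℓ where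
  field
    sound    : ∀ i → X (L i)
    once     : ∀ x → X x → ∃! _≡_ (λ i → L i ≡ x)
    monotone : ∀ i j → L i <ᴮ L j → i < j

record IsShellingOrder (k : ℕ) (C : Vector (Subset n) h) : Set where
  field
    conf  : IsConf k C
    shell : ∀ i j → i < j →
            ∃[ z ] (z < j × ∣ C z ∩ C j ∣ ≡ k ∸ 1 × C i ∩ C j ⊆ C z ∩ C j)

{-# OPTIONS --safe #-}

-- Fix y = L_j and let x = L_i come before y.  If max (y \ x) > max (x \ y), the
-- exchange property for (y, x) replaces an element of y \ x by a smaller one of
-- x \ y; the result lies in X strictly below y, so it precedes y in L, and it
-- still contains x ∩ y.  Otherwise the exchange property for (x, y) yields an
-- x' < x in X with x ∩ y ⊆ x', and one recurses on the earlier position of x'.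
module Submission where

open import Defs
open import Data.Bool.Base using (true; false)
open import Data.Fin.Base as Fin using (Fin; zero; suc)
open import Data.Fin.Induction using (<-wellFounded)
open import Data.Fin.Properties as Fin using (<-cmp)
open import Data.Fin.Subset as Subset
  using (Subset; inside; outside; _∈_; _∉_; _∩_; _∪_; _─_; ⁅_⁆; ∣_∣; ⊥; Nonempty)
open import Data.Fin.Subset.Properties
open import Data.List.Base using (List; []; _∷_; allFin; filter; map; tabulate)
open import Data.List.Properties using (map-tabulate)
open import Data.List.Relation.Binary.Pointwise as Pointwise using (Pointwise; _∷_)
open import Data.Nat.Base as ℕ using (ℕ; _≤_; z≤n; s≤s; _∸_)
import Data.Nat.Properties as ℕ
open import Data.Product using (_×_; _,_; proj₁; proj₂; ∃-syntax)
open import Data.Sum.Base using (inj₁; inj₂; [_,_]′)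
open import Data.Vec.Base using ([]; _∷_; here; there)
open import Data.Vec.Functional using (Vector)
open import Function.Base using (_∘_; id)
open import Function.Definitions using (Injective)
open import Induction.WellFounded using (Acc; acc)
open import Level using (Level)
open import Relation.Binary.Definitions using (Tri; tri<; tri≈; tri>)
open import Relation.Binary.PropositionalEquality
  using (_≡_; _≢_; refl; sym; trans; cong; subst; subst₂)
open import Relation.Nullary using (yes; no; does; contradiction)
open import Relation.Unary using (Pred; _⊆_)

private
  variable
    n : ℕ
    i j p : Fin n
    x y : Subset n

-- Increasing tuples and the Bruhat order.

filter-∈?-map-suc : ∀ s (x : Subset n) is →
  filter (_∈? (s ∷ x)) (map suc is) ≡ map suc (filter (_∈? x) is)
filter-∈?-map-suc s x []       = refl
-- `suc i ∈? (s ∷ x)` and `i ∈? x` share the same `does`, so one case split reduces both filters.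
filter-∈?-map-suc s x (i ∷ is) with does (i ∈? x)
... | true  = cong (suc i ∷_) (filter-∈?-map-suc s x is)
... | false = filter-∈?-map-suc s x is

filter-∈?-tail : ∀ s (x : Subset n) →
  filter (_∈? (s ∷ x)) (tabulate suc) ≡ map suc (elements x)
filter-∈?-tail s x = trans
  (cong (filter (_∈? (s ∷ x))) (sym (map-tabulate id suc)))
  (filter-∈?-map-suc s x (allFin _))

elements-inside : (x : Subset n) → elements (inside ∷ x) ≡ zero ∷ map suc (elements x)
elements-inside x = cong (zero ∷_) (filter-∈?-tail inside x)

elements-outside : (x : Subset n) → elements (outside ∷ x) ≡ map suc (elements x)
elements-outside x = filter-∈?-tail outside x

map-suc⁺ : ∀ {is js : List (Fin n)} →
  Pointwise Fin._≤_ is js → Pointwise Fin._≤_ (map suc is) (map suc js)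
map-suc⁺ = Pointwise.map⁺ suc suc ∘ Pointwise.map s≤s

∷-mono-≤ᴮ : ∀ s → x ≤ᴮ y → (s ∷ x) ≤ᴮ (s ∷ y)
∷-mono-≤ᴮ {x = x} {y = y} inside x≤y
  rewrite elements-inside x | elements-inside y = z≤n ∷ map-suc⁺ x≤y
∷-mono-≤ᴮ {x = x} {y = y} outside x≤y
  rewrite elements-outside x | elements-outside y = map-suc⁺ x≤y

△-identityʳ : (x : Subset n) → x △ ⊥ ≡ x
△-identityʳ []            = refl
△-identityʳ (inside  ∷ x) = cong (inside ∷_) (△-identityʳ x)
△-identityʳ (outside ∷ x) = cong (outside ∷_) (△-identityʳ x)

-- Trades the element i for a new smallest element.  Here subst₂ is used because
-- rewrite cannot match x △ y under _∷_: the local function of _─_ captures both sets.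
zero∷elements-△ : i ∈ x →
  Pointwise Fin._≤_ (zero ∷ map suc (elements (x △ ⁅ i ⁆))) (map suc (elements x))
zero∷elements-△ {x = _ ∷ x} here = subst₂ (Pointwise Fin._≤_)
  (cong (λ is → zero ∷ map suc is)
    (sym (trans (cong (elements ∘ (outside ∷_)) (△-identityʳ x)) (elements-outside x))))
  (cong (map suc) (sym (elements-inside x)))
  (z≤n ∷ Pointwise.refl ℕ.≤-refl)
zero∷elements-△ {i = suc i} {x = inside ∷ x} (there i∈x) = subst₂ (Pointwise Fin._≤_)
  (cong (λ is → zero ∷ map suc is) (sym (elements-inside (x △ ⁅ i ⁆))))
  (cong (map suc) (sym (elements-inside x)))
  (z≤n ∷ map-suc⁺ (zero∷elements-△ i∈x))
zero∷elements-△ {i = suc i} {x = outside ∷ x} (there i∈x) = subst₂ (Pointwise Fin._≤_)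
  (cong (λ is → zero ∷ map suc is) (sym (elements-outside (x △ ⁅ i ⁆))))
  (cong (map suc) (sym (elements-outside x)))
  (lower-head (map-suc⁺ (zero∷elements-△ i∈x)))
  where
  lower-head : ∀ {m} {is js : List (Fin (ℕ.suc (ℕ.suc m)))} →
    Pointwise Fin._≤_ (suc zero ∷ is) js → Pointwise Fin._≤_ (zero ∷ is) js
  lower-head (_ ∷ is≤js) = z≤n ∷ is≤js

-- Trading `i` for the least point moves the entries below `i` one place to the right, so every
-- place up to that of `i` receives a smaller entry; later places are unchanged.
inside∷△-≤ᴮ : i ∈ x → (inside ∷ (x △ ⁅ i ⁆)) ≤ᴮ (outside ∷ x)
inside∷△-≤ᴮ {i = i} {x = x} i∈x = subst₂ (Pointwise Fin._≤_)
  (sym (elements-inside (x △ ⁅ i ⁆))) (sym (elements-outside x)) (zero∷elements-△ i∈x)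

-- Peeling off common heads reduces to `j = zero`, where `i` is traded for a new least element.
exchange-≤ᴮ : j Fin.< i → i ∈ x → j ∉ x → x △ (⁅ i ⁆ ∪ ⁅ j ⁆) ≤ᴮ x
exchange-≤ᴮ {j = zero} {suc i} {inside  ∷ x} j<i i∈x j∉x = contradiction here j∉x
exchange-≤ᴮ {j = zero} {suc i} {outside ∷ x} j<i (there i∈x) j∉x
  -- The tail of `⁅ suc i ⁆ ∪ ⁅ zero ⁆` is `⁅ i ⁆ ∪ ⊥`, which must become `⁅ i ⁆`.
  rewrite ∪-identityʳ ⁅ i ⁆ = inside∷△-≤ᴮ i∈x
exchange-≤ᴮ {j = suc j} {suc i} {inside ∷ x} (s≤s j<i) (there i∈x) j∉x =
  ∷-mono-≤ᴮ inside (exchange-≤ᴮ j<i i∈x (j∉x ∘ there))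
exchange-≤ᴮ {j = suc j} {suc i} {outside ∷ x} (s≤s j<i) (there i∈x) j∉x =
  ∷-mono-≤ᴮ outside (exchange-≤ᴮ j<i i∈x (j∉x ∘ there))

-- Strict descent and intersections under an exchange.

∈─⇒∈ : ∀ (x y : Subset n) → p ∈ x ─ y → p ∈ x
∈─⇒∈ x y = p─q⊆p x y

∈─⇒∉ : ∀ (x y : Subset n) → p ∈ x ─ y → p ∉ y
∈─⇒∉ (_ ∷ x) (inside  ∷ y) (there p∈) (there p∈y) = ∈─⇒∉ x y p∈ p∈y
∈─⇒∉ (_ ∷ x) (outside ∷ y) (there p∈) (there p∈y) = ∈─⇒∉ x y p∈ p∈y

∉-△ : ∀ (x y : Subset n) → p ∈ x → p ∈ y → p ∉ x △ y
∉-△ x y p∈x p∈y p∈△ with x∈p∪q⁻ (x ─ y) (y ─ x) p∈△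
... | inj₁ p∈x─y = ∈─⇒∉ x y p∈x─y p∈y
... | inj₂ p∈y─x = ∈─⇒∉ y x p∈y─x p∈x

exchange-<ᴮ : j Fin.< i → i ∈ x → j ∉ x → x △ (⁅ i ⁆ ∪ ⁅ j ⁆) <ᴮ x
exchange-<ᴮ {j = j} {i} {x} j<i i∈x j∉x =
  exchange-≤ᴮ j<i i∈x j∉x ,
  λ x′≡x → ∉-△ x (⁅ i ⁆ ∪ ⁅ j ⁆) i∈x (x∈p∪q⁺ (inj₁ (x∈⁅x⁆ i))) (subst (i ∈_) (sym x′≡x) i∈x)

∣△∩∣ : i ∈ x → ℕ.suc ∣ (x △ ⁅ i ⁆) ∩ x ∣ ≡ ∣ x ∣
∣△∩∣ {x = _ ∷ x} here =
  cong (ℕ.suc ∘ ∣_∣) (trans (cong (_∩ x) (△-identityʳ x)) (∩-idem x))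
∣△∩∣ {x = inside  ∷ x} (there i∈x) = cong ℕ.suc (∣△∩∣ i∈x)
∣△∩∣ {x = outside ∷ x} (there i∈x) = ∣△∩∣ i∈x

-- Intersecting with `x` drops the incoming `j`, so only `i` is lost; the form with `suc` keeps
-- truncated subtraction out of the induction.
∣exchange∩∣ : j Fin.< i → i ∈ x → j ∉ x →
  ℕ.suc ∣ (x △ (⁅ i ⁆ ∪ ⁅ j ⁆)) ∩ x ∣ ≡ ∣ x ∣
∣exchange∩∣ {j = zero} {suc i} {inside  ∷ x} j<i i∈x j∉x = contradiction here j∉x
∣exchange∩∣ {j = zero} {suc i} {outside ∷ x} j<i (there i∈x) j∉x
  rewrite ∪-identityʳ ⁅ i ⁆ = ∣△∩∣ i∈x
∣exchange∩∣ {j = suc j} {suc i} {inside ∷ x} (s≤s j<i) (there i∈x) j∉x =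
  cong ℕ.suc (∣exchange∩∣ j<i i∈x (j∉x ∘ there))
∣exchange∩∣ {j = suc j} {suc i} {outside ∷ x} (s≤s j<i) (there i∈x) j∉x =
  ∣exchange∩∣ j<i i∈x (j∉x ∘ there)

-- A point of `x` can only be lost by lying in the pair, but `i` is not in `y` and `j` is not in
-- `x`. This supplies the containment demanded of a shelling.
exchange-⊇-∩ : i ∈ x ─ y → j ∈ y ─ x → p ∈ x → p ∈ y → p ∈ x △ (⁅ i ⁆ ∪ ⁅ j ⁆)
exchange-⊇-∩ {i = i} {x} {y} {j} i∈ j∈ p∈x p∈y =
  x∈p∪q⁺ (inj₁ (x∈p∧x∉q⇒x∈p─q p∈x
    ([ (λ p∈i → ∈─⇒∉ x y i∈ (subst (_∈ y) (x∈⁅y⁆⇒x≡y i p∈i) p∈y))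
     , (λ p∈j → ∈─⇒∉ y x j∈ (subst (_∈ x) (x∈⁅y⁆⇒x≡y j p∈j) p∈x))
     ]′ ∘ x∈p∪q⁻ ⁅ i ⁆ ⁅ j ⁆)))

-- Maxima and set differences.

max-exists : (x : Subset n) → Nonempty x → ∃[ m ] m IsMaxOf x
max-exists (s ∷ x) ne with nonempty? x
max-exists (s ∷ x) ne | yes ne′ with m , m∈x , max ← max-exists x ne′ =
  suc m , there m∈x , λ where
    zero    _           → z≤n
    (suc j) (there j∈x) → s≤s (max j j∈x)
max-exists (s ∷ x) (suc i , there i∈x) | no ¬ne = contradiction (i , i∈x) ¬ne
max-exists (s ∷ x) (zero  , here)      | no ¬ne =
  zero , here , λ where
    zero    _           → z≤n
    (suc j) (there j∈x) → contradiction (j , j∈x) ¬ne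

¬─⇒⊆ : Subset.Empty (x ─ y) → x Subset.⊆ y
¬─⇒⊆ {x = x} {y} empty {p} p∈x with p ∈? y
... | yes p∈y = p∈y
... | no  p∉y = contradiction (p , x∈p∧x∉q⇒x∈p─q p∈x p∉y) empty

-- If `x ─ y` is empty then `x` lies in `y`, and equal sizes leave no room for a proper inclusion.
─-nonempty : ∣ x ∣ ≡ ∣ y ∣ → x ≢ y → Nonempty (x ─ y)
─-nonempty {x = x} {y} ∣x∣≡∣y∣ x≢y with nonempty? (x ─ y) | nonempty? (y ─ x)
... | yes ne | _                = ne
... | no  x─y | no y─x          = contradiction (⊆-antisym (¬─⇒⊆ x─y) (¬─⇒⊆ y─x)) x≢y
... | no  x─y | yes (p , p∈y─x) = contradiction ∣x∣≡∣y∣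
  (ℕ.<⇒≢ (p⊂q⇒∣p∣<∣q∣ (¬─⇒⊆ x─y , p , ∈─⇒∈ y x p∈y─x , ∈─⇒∉ y x p∈y─x)))

-- Two positions with the same value must both be the one index that `once` provides for it.
linearExtension-injective : ∀ {ℓ h} {X : Pred (Subset n) ℓ} {L : Vector (Subset n) h} →
  IsLinearExtension X L → Injective _≡_ _≡_ L
linearExtension-injective {L = L} ext {_} {b} La≡Lb
  with _ , _ , unique ← IsLinearExtension.once ext (L b) (IsLinearExtension.sound ext b) =
  trans (sym (unique La≡Lb)) (unique refl)

-- Exchanges inside a linear extension.

module _ {ℓ} {k h : ℕ} {X : Pred (Subset n) ℓ} (X⊆ : X ⊆ KSubset n k)
  (qe : QuasiExchange X) {L : Vector (Subset n) h} (ext : IsLinearExtension X L) where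

  open IsLinearExtension ext

  -- Used twice: at the later facet, `z` is the shelling witness; at the earlier one, `z` is the
  -- position to recurse on.
  exchange : ∀ a (y : Subset n) → X y → i ∈ L a ─ y →
    j IsMaxOf (y ─ L a) → j Fin.< i →
    ∃[ z ] (z Fin.< a × ∣ L z ∩ L a ∣ ≡ k ∸ 1 × (∀ {p} → p ∈ L a → p ∈ y → p ∈ L z))
  exchange a y Xy i∈ m-max m<i
    with j , j∈ , Xx′ ← qe (L a) y (sound a) Xy _ i∈ _ m-max m<i
    with z , Lz≡ , _ ← once _ Xx′ =
      z
    , monotone z a (subst (_<ᴮ L a) (sym Lz≡) (exchange-<ᴮ j<i i∈La j∉La))
    , trans (cong (λ x → ∣ x ∩ L a ∣) Lz≡)
        (cong ℕ.pred (trans (∣exchange∩∣ j<i i∈La j∉La) (X⊆ (sound a))))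
    , λ p∈La p∈y → subst (_ ∈_) (sym Lz≡) (exchange-⊇-∩ i∈ j∈ p∈La p∈y)
    where
    -- Any partner `j` that `qe` returns is at most the maximum of `y ─ L a`, hence below `i`, so
    -- the exchange always descends.
    j<i  = ℕ.≤-<-trans (proj₂ m-max j j∈) m<i
    i∈La = ∈─⇒∈ (L a) y i∈
    j∉La = ∈─⇒∉ y (L a) j∈

  shelling : ∀ {a} b → Acc Fin._<_ a → a Fin.< b →
    ∃[ z ] (z Fin.< b × ∣ L z ∩ L b ∣ ≡ k ∸ 1 × L a ∩ L b Subset.⊆ L z ∩ L b)
  shelling {a} b (acc rec) a<b = compare (<-cmp (proj₁ max-a) (proj₁ max-b))
    where
    ∣La∣≡∣Lb∣ = trans (X⊆ (sound a)) (sym (X⊆ (sound b)))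
    La≢Lb : L a ≢ L b
    La≢Lb = Fin.<⇒≢ a<b ∘ linearExtension-injective ext
    max-a = max-exists (L a ─ L b) (─-nonempty ∣La∣≡∣Lb∣ La≢Lb)
    max-b = max-exists (L b ─ L a) (─-nonempty (sym ∣La∣≡∣Lb∣) (La≢Lb ∘ sym))

    compare : Tri (proj₁ max-a Fin.< proj₁ max-b) (proj₁ max-a ≡ proj₁ max-b)
                  (proj₁ max-b Fin.< proj₁ max-a) →
      ∃[ z ] (z Fin.< b × ∣ L z ∩ L b ∣ ≡ k ∸ 1 × L a ∩ L b Subset.⊆ L z ∩ L b)
    compare (tri< m<i _ _)
      with z , z<b , ∣∩∣ , ∩⊆ ←
        exchange b (L a) (sound a) (proj₁ (proj₂ max-b)) (proj₂ max-a) m<i =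
      z , z<b , ∣∩∣ , λ p∈ → let p∈La , p∈Lb = x∈p∩q⁻ (L a) (L b) p∈ in
        x∈p∩q⁺ (∩⊆ p∈Lb p∈La , p∈Lb)
    -- Equal maxima would be a common point of two disjoint differences.
    compare (tri≈ _ m≡i _) = contradiction
      (∈─⇒∈ (L b) (L a) (proj₁ (proj₂ max-b)))
      (∈─⇒∉ (L a) (L b) (subst (_∈ L a ─ L b) m≡i (proj₁ (proj₂ max-a))))
    -- `L a′` need not be adjacent to `L b`; it only has to come earlier and keep `L a ∩ L b`, so
    -- that a witness for it also serves `L a`.
    compare (tri> _ _ m<i)
      with a′ , a′<a , _ , ∩⊆ ←
        exchange a (L b) (sound b) (proj₁ (proj₂ max-a)) (proj₂ max-b) m<i
      with z , z<b , ∣∩∣ , La′∩Lb⊆ ← shelling b (rec a′<a) (ℕ.<-trans a′<a a<b) =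
      z , z<b , ∣∩∣ , λ p∈ → let p∈La , p∈Lb = x∈p∩q⁻ (L a) (L b) p∈ in
        La′∩Lb⊆ (x∈p∩q⁺ (∩⊆ p∈La p∈Lb , p∈Lb))

theorem3p4 : ∀ {ℓ : Level} (k n : ℕ) → 1 ≤ k → 1 ≤ n → k ≤ n →
    (X : Pred (Subset n) ℓ) → X ⊆ KSubset n k → QuasiExchange X →
    (h : ℕ) → 1 ≤ h → (L : Vector (Subset n) h) →
    IsLinearExtension X L → IsShellingOrder k L
theorem3p4 k n 1≤k 1≤n k≤n X X⊆ qe h 1≤h L ext = record
  { conf = record
    { nonempty = 1≤h
    ; facets   = X⊆ ∘ IsLinearExtension.sound ext
    ; distinct = linearExtension-injective ext
    }
  ; shell = λ a b → shelling X⊆ qe ext b (<-wellFounded a)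
  }
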